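{- Let $r,k,p,q$ be integers, all greater than $1$, with $r\ge k$, $p\ge k+1$ and $2\le q\le\binom{p}{k}$. Then \[ F_k(r,p,q) \le r^{\binom{F_{k-1}(r,p-1,q)}{k-1}}. \] Here, when $q>\binom{p-1}{k-1}$, $F_{k-1}(r,p-1,q)$ is interpreted as $p-1$.
   Context: For positive integers $k,p,q$ with $p\ge k+1$ and $2\le q\le\binom{p}{k}$, and a positive integer $r$, $F_k(r,p,q)$ is the minimum integer $n$ such that every coloring of the edges of the complete $k$-uniform hypergraph $K_n^{(k)}$ with $r$ colors contains a copy of $K_p^{(k)}$ (i.e. a set of $p$ vertices) whose edges receive at most $q-1$ distinct colors. (For $k=1$, $K_n^{(1)}$ has the $n$ singletons as edges, so the coloring is a coloring of vertices.) -}

module Defs where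

open import Data.Bool.Base using (true)
open import Data.Empty using (⊥-elim)
open import Data.Fin.Base using (Fin; zero; suc; toℕ)
import Data.Fin.Properties as Fin
open import Data.Fin.Subset
open import Data.Fin.Subset.Properties
open import Data.Nat.Base
open import Data.Nat.Combinatorics using (_C_)
open import Data.Nat.Properties
open import Data.Product.Base using (Σ; ∃; _×_; _,_; proj₁; proj₂)
open import Data.Unit.Base using (tt) renaming (⊤ to Unit)
open import Data.Vec.Base using ([]; _∷_; here; there; tabulate)
open import Data.Vec.Properties using (lookup∘tabulate; []=⇒lookup; lookup⇒[]=)
open import Function.Base using (_∘_; id)
open import Relation.Binary.PropositionalEquality
open import Relation.Nullary using (Dec; yes; no; does; contradiction)
open import Relation.Nullary.Decidable using (map′; _×-dec_; dec-true)
open import Relation.Unary using (Decidable)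

private variable
  k m n p q r : ℕ

------------------------------------------------------------------------
-- Colourings of complete uniform hypergraphs

-- The edges of K_n^(k): the k-element subsets of Fin n.
Edge : ℕ → ℕ → Set
Edge k n = Σ (Subset n) λ e → ∣ e ∣ ≡ k

Colouring : ℕ → ℕ → ℕ → Set
Colouring k r n = Edge k n → Fin r

Appears : Colouring k r n → Subset n → Fin r → Set
Appears χ P c = ∃ λ e → proj₁ e ⊆ P × χ e ≡ c

appears? : (χ : Colouring k r n) (P : Subset n) → Decidable (Appears χ P)
appears? {k} χ P c =
  map′ {A = ∃ AppearsAt} (λ (e , s , e⊆P , eq) → (e , s) , e⊆P , eq)
       (λ ((e , s) , e⊆P , eq) → e , s , e⊆P , eq)
       (anySubset? appearsAt?)
  where
  AppearsAt : Subset _ → Set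
  AppearsAt e = Σ (∣ e ∣ ≡ k) λ s → e ⊆ P × χ (e , s) ≡ c

  appearsAt? : Decidable AppearsAt
  appearsAt? e with ∣ e ∣ ≟ k
  ... | no  e≢k = no (e≢k ∘ proj₁)
  ... | yes s   = map′ {A = e ⊆ P × χ (e , s) ≡ c} (λ (e⊆P , eq) → s , e⊆P , eq)
    (λ (s′ , e⊆P , eq) → e⊆P , trans (cong (λ s → χ (e , s)) (≡-irrelevant s s′)) eq)
    ((e ⊆? P) ×-dec (χ (e , s) Fin.≟ c))

-- The set of colours received by the edges of the copy of K_p^(k) on P.
colours : Colouring k r n → Subset n → Subset r
colours χ P = tabulate λ c → does (appears? χ P c)

FewColours : ℕ → ℕ → Colouring k r n → Set
FewColours p q χ = ∃ λ P → ∣ P ∣ ≡ p × ∣ colours χ P ∣ ≤ q ∸ 1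

Arrows : (k r p q n : ℕ) → Set
Arrows k r p q n = (χ : Colouring k r n) → FewColours p q χ

IsLeast : (ℕ → Set) → ℕ → Set
IsLeast P n = P n × (∀ m → P m → n ≤ m)

∈colours⁻ : (χ : Colouring k r n) (P : Subset n) {c : Fin r} →
            c ∈ colours χ P → Appears χ P c
∈colours⁻ χ P {c} c∈ = witness (appears? χ P c)
  (trans (sym (lookup∘tabulate (does ∘ appears? χ P) c)) ([]=⇒lookup c∈))
  where
  witness : {A : Set} (a? : Dec A) → does a? ≡ true → A
  witness (yes a) _ = a

∈colours⁺ : (χ : Colouring k r n) (P : Subset n) {c : Fin r} →
            Appears χ P c → c ∈ colours χ P
∈colours⁺ χ P {c} a = lookup⇒[]= c (colours χ P)
  (trans (lookup∘tabulate (does ∘ appears? χ P) c) (dec-true (appears? χ P c) a))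

------------------------------------------------------------------------
-- Arrows is decidable, by running through all colourings

Extensional : (Colouring k r n → Set) → Set
Extensional Q = ∀ χ χ′ → χ ≗ χ′ → Q χ → Q χ′

private
  join₀ : Colouring 0 r n → Colouring 0 r (suc n)
  join₀ χ (outside ∷ e , s) = χ (e , s)

  join : Colouring k r n → Colouring (suc k) r n → Colouring (suc k) r (suc n)
  join χ χ′ (inside  ∷ e , s) = χ (e , suc-injective s)
  join χ χ′ (outside ∷ e , s) = χ′ (e , s)

allColourings? : ∀ k n {Q : Colouring k r n → Set} → Extensional Q →
                 Decidable Q → Dec (∀ χ → Q χ)
allColourings? zero zero ext Q? = map′
  (λ h χ → ext _ _ (λ { ([] , refl) → refl }) (h (χ ([] , refl))))
  (λ h c → h (λ _ → c))
  (Fin.all? λ c → Q? (λ _ → c))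
allColourings? (suc k) zero ext Q? = map′
  (λ h χ → ext _ _ (λ { ([] , ()) }) h)
  (λ h → h _)
  (Q? λ { ([] , ()) })
allColourings? zero (suc n) ext Q? = map′
  (λ h χ → ext _ _ (λ { (outside ∷ e , s) → refl ; (inside ∷ e , ()) })
                   (h λ (e , s) → χ (outside ∷ e , s)))
  (λ h χ → h (join₀ χ))
  (allColourings? zero n
    (λ χ χ′ eq → ext _ _ λ { (outside ∷ e , s) → eq (e , s) ; (inside ∷ e , ()) })
    (λ χ → Q? (join₀ χ)))
allColourings? (suc k) (suc n) ext Q? = map′
  (λ h χ → ext _ _
    (λ { (outside ∷ e , s) → refl
       ; (inside ∷ e , s) → cong (λ s → χ (inside ∷ e , s)) (≡-irrelevant _ _) })
    (h (λ (e , s) → χ (inside ∷ e , cong suc s)) (λ (e , s) → χ (outside ∷ e , s))))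
  (λ h χ χ′ → h (join χ χ′))
  (allColourings? k n
    (λ χ χ′ eq h χ″ → ext _ _
      (λ { (outside ∷ e , s) → refl ; (inside ∷ e , s) → eq _ }) (h χ″))
    (λ χ → allColourings? (suc k) n
      (λ χ′ χ″ eq → ext _ _
        λ { (outside ∷ e , s) → eq (e , s) ; (inside ∷ e , s) → refl })
      (λ χ′ → Q? (join χ χ′))))

arrows? : ∀ k r p q → Decidable (Arrows k r p q)
arrows? k r p q n = allColourings? k n
  (λ χ χ′ eq (P , ∣P∣ , few) → P , ∣P∣ ,
    ≤-trans (p⊆q⇒∣p∣≤∣q∣ λ {c} c∈ →
      let (e , e⊆P , χ′e) = ∈colours⁻ χ′ P c∈
      in ∈colours⁺ χ P (e , e⊆P , trans (eq e) χ′e)) few)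
  (λ χ → anySubset? λ P → (∣ P ∣ ≟ p) ×-dec (∣ colours χ P ∣ ≤? q ∸ 1))

least : {P : ℕ → Set} → Decidable P → ∀ n → P n → ∃ (IsLeast P)
least {P} P? zero    p = 0 , p , λ _ _ → z≤n
least {P} P? (suc n) p with P? 0
... | yes p₀ = 0 , p₀ , λ _ _ → z≤n
... | no ¬p₀ with least (P? ∘ suc) n p
...   | m , pm , min = suc m , pm , λ
  { zero p₀ → contradiction p₀ ¬p₀ ; (suc j) pj → s≤s (min j pj) }

------------------------------------------------------------------------
-- Ramsey's theorem, needed only for F below to be well defined

private
  ∣p∣≡0⇒p≡⊥ : (e : Subset n) → ∣ e ∣ ≡ 0 → e ≡ ⊥
  ∣p∣≡0⇒p≡⊥ []            _ = refl
  ∣p∣≡0⇒p≡⊥ (outside ∷ e) s = cong (outside ∷_) (∣p∣≡0⇒p≡⊥ e s)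

  shrink : ∀ m (Q : Subset n) → m ≤ ∣ Q ∣ → ∃ λ Q′ → Q′ ⊆ Q × ∣ Q′ ∣ ≡ m
  shrink {n} zero Q _ = ⊥ , ⊥-elim ∘ ∉⊥ , ∣⊥∣≡0 n
  shrink (suc m) (outside ∷ Q) le with shrink (suc m) Q le
  ... | Q′ , sub , s = outside ∷ Q′ , out⊆ sub , s
  shrink (suc m) (inside ∷ Q) (s≤s le) with shrink m Q le
  ... | Q′ , sub , s = inside ∷ Q′ , in⊆in sub , cong suc s

  -- The image of a subset under the increasing bijection Fin ∣ P ∣ → P.
  embed : (P : Subset n) → Subset ∣ P ∣ → Subset n
  embed []            _       = []
  embed (outside ∷ P) e       = outside ∷ embed P e
  embed (inside  ∷ P) (x ∷ e) = x ∷ embed P e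

  ∣embed∣ : (P : Subset n) (e : Subset ∣ P ∣) → ∣ embed P e ∣ ≡ ∣ e ∣
  ∣embed∣ []            []            = refl
  ∣embed∣ (outside ∷ P) e             = ∣embed∣ P e
  ∣embed∣ (inside  ∷ P) (outside ∷ e) = ∣embed∣ P e
  ∣embed∣ (inside  ∷ P) (inside  ∷ e) = cong suc (∣embed∣ P e)

  embed⊆ : (P : Subset n) (e : Subset ∣ P ∣) → embed P e ⊆ P
  embed⊆ []            e             = λ ()
  embed⊆ (outside ∷ P) e             = out⊆ (embed⊆ P e)
  embed⊆ (inside  ∷ P) (outside ∷ e) = out⊆ (embed⊆ P e)
  embed⊆ (inside  ∷ P) (inside  ∷ e) = in⊆in (embed⊆ P e)

  unembed : (P : Subset n) (Q : Subset ∣ P ∣) (e : Subset n) → e ⊆ embed P Q →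
            ∃ λ e′ → e′ ⊆ Q × embed P e′ ≡ e
  unembed [] [] [] _ = [] , id , refl
  unembed (outside ∷ P) Q (inside ∷ e) sub with () ← sub here
  unembed (outside ∷ P) Q (outside ∷ e) sub with unembed P Q e (drop-∷-⊆ sub)
  ... | e′ , sub′ , eq = e′ , sub′ , cong (outside ∷_) eq
  unembed (inside ∷ P) (outside ∷ Q) (inside ∷ e) sub with () ← sub here
  unembed (inside ∷ P) (x ∷ Q) (outside ∷ e) sub with unembed P Q e (drop-∷-⊆ sub)
  ... | e′ , sub′ , eq = outside ∷ e′ , out⊆ sub′ , cong (outside ∷_) eq
  unembed (inside ∷ P) (inside ∷ Q) (inside ∷ e) sub with unembed P Q e (drop-∷-⊆ sub)
  ... | e′ , sub′ , eq = inside ∷ e′ , in⊆in sub′ , cong (inside ∷_) eq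

  Hom : ℕ → (Subset n → ℕ) → ℕ → Subset n → Set
  Hom k χ c P = ∀ e → e ⊆ P → ∣ e ∣ ≡ k → χ e ≡ c

  -- The colour of a (k+1)-subset of P depends only on its least element.
  EndHom : ℕ → ℕ → (Subset n → ℕ) → Subset n → Set
  EndHom b k χ []            = Unit
  EndHom b k χ (outside ∷ P) = EndHom b k (χ ∘ (outside ∷_)) P
  EndHom b k χ (inside  ∷ P) =
    (∃ λ c → c < b × Hom k (χ ∘ (inside ∷_)) c P) × EndHom b k (χ ∘ (outside ∷_)) P

  head-colour : ∀ {b k} {χ : Subset n → ℕ} (P : Subset n) → EndHom b k χ P → Fin n → ℕ
  head-colour (outside ∷ P) h             zero    = 0
  head-colour (outside ∷ P) h             (suc x) = head-colour P h x
  head-colour (inside  ∷ P) ((c , _) , h) zero    = c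
  head-colour (inside  ∷ P) (_ , h)       (suc x) = head-colour P h x

  head-colour< : ∀ {b k} {χ : Subset n → ℕ} (P : Subset n) (h : EndHom b k χ P) →
                 ∀ x → x ∈ P → head-colour P h x < b
  head-colour< (inside  ∷ P) ((_ , c<b , _) , _) zero    here      = c<b
  head-colour< (inside  ∷ P) (_ , h)             (suc x) (there i) = head-colour< P h x i
  head-colour< (outside ∷ P) h                   (suc x) (there i) = head-colour< P h x i

  endHom⇒hom : ∀ {b k c} {χ : Subset n → ℕ} (P : Subset n) (h : EndHom b k χ P) e → e ⊆ P →
               (∀ x → x ∈ e → head-colour P h x ≡ c) → ∣ e ∣ ≡ suc k → χ e ≡ c
  endHom⇒hom (outside ∷ P) h (inside ∷ e) sub eq s with () ← sub here
  endHom⇒hom (outside ∷ P) h (outside ∷ e) sub eq s =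
    endHom⇒hom P h e (drop-∷-⊆ sub) (λ x i → eq (suc x) (there i)) s
  endHom⇒hom (inside ∷ P) (_ , h) (outside ∷ e) sub eq s =
    endHom⇒hom P h e (drop-∷-⊆ sub) (λ x i → eq (suc x) (there i)) s
  endHom⇒hom (inside ∷ P) ((_ , _ , h) , _) (inside ∷ e) sub eq s =
    trans (h e (drop-∷-⊆ sub) (suc-injective s)) (eq zero here)

  endHom-embed : ∀ {b k} (χ : Subset n → ℕ) (P : Subset n) (Q : Subset ∣ P ∣) →
                 EndHom b k (χ ∘ embed P) Q → EndHom b k χ (embed P Q)
  endHom-embed χ []            Q             h = tt
  endHom-embed χ (outside ∷ P) Q             h = endHom-embed (χ ∘ (outside ∷_)) P Q h
  endHom-embed χ (inside  ∷ P) (outside ∷ Q) h = endHom-embed (χ ∘ (outside ∷_)) P Q h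
  endHom-embed χ (inside  ∷ P) (inside  ∷ Q) ((c , c<b , hom) , h) =
    (c , c<b , hom′) , endHom-embed (χ ∘ (outside ∷_)) P Q h
    where
    hom′ : Hom _ (χ ∘ (inside ∷_)) c (embed P Q)
    hom′ e sub s with unembed P Q e sub
    ... | e′ , sub′ , refl = hom e′ sub′ (trans (sym (∣embed∣ P e′)) s)

  split : (P : Subset n) (g : Fin n → ℕ) (b : ℕ) → ∃ λ A → ∃ λ B →
          (∀ x → x ∈ A → x ∈ P × g x ≡ b) × (∀ x → x ∈ B → x ∈ P × g x ≢ b) ×
          ∣ P ∣ ≡ ∣ A ∣ + ∣ B ∣
  split [] g b = [] , [] , (λ _ ()) , (λ _ ()) , refl
  split (outside ∷ P) g b with split P (g ∘ suc) b
  ... | A , B , hA , hB , s = outside ∷ A , outside ∷ B ,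
    (λ { (suc x) (there i) → there (proj₁ (hA x i)) , proj₂ (hA x i) }) ,
    (λ { (suc x) (there i) → there (proj₁ (hB x i)) , proj₂ (hB x i) }) , s
  split (inside ∷ P) g b with split P (g ∘ suc) b | g zero ≟ b
  ... | A , B , hA , hB , s | yes eq = inside ∷ A , outside ∷ B ,
    (λ { zero here → here , eq
       ; (suc x) (there i) → there (proj₁ (hA x i)) , proj₂ (hA x i) }) ,
    (λ { (suc x) (there i) → there (proj₁ (hB x i)) , proj₂ (hB x i) }) , cong suc s
  ... | A , B , hA , hB , s | no neq = outside ∷ A , inside ∷ B ,
    (λ { (suc x) (there i) → there (proj₁ (hA x i)) , proj₂ (hA x i) }) ,
    (λ { zero here → here , neq
       ; (suc x) (there i) → there (proj₁ (hB x i)) , proj₂ (hB x i) }) ,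
    trans (cong suc s) (sym (+-suc ∣ A ∣ ∣ B ∣))

  pigeonhole : ∀ b m (P : Subset n) (g : Fin n → ℕ) → (∀ x → x ∈ P → g x < b) →
               b * m < ∣ P ∣ →
               ∃ λ c → ∃ λ Q → Q ⊆ P × ∣ Q ∣ ≡ m × (∀ x → x ∈ Q → g x ≡ c)
  pigeonhole {n} zero m P g g< lt with nonempty? P
  ... | yes (x , i) with () ← g< x i
  ... | no  ¬ne     = contradiction (trans (cong ∣_∣ (Empty-unique ¬ne)) (∣⊥∣≡0 n)) (>⇒≢ lt)
  pigeonhole (suc b) m P g g< lt with split P g b
  ... | A , B , hA , hB , s with m ≤? ∣ A ∣
  ...   | yes le with shrink m A le
  ...     | Q , sub , sQ = b , Q , (λ i → proj₁ (hA _ (sub i))) , sQ , λ x i → proj₂ (hA x (sub i))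
  pigeonhole (suc b) m P g g< lt | A , B , hA , hB , s | no nle
    with pigeonhole b m B g (λ x i → ≤∧≢⇒< (≤-pred (g< x (proj₁ (hB x i)))) (proj₂ (hB x i)))
           (+-cancelˡ-< m (b * m) ∣ B ∣ (<-≤-trans (subst (m + b * m <_) s lt)
             (+-monoˡ-≤ ∣ B ∣ (<⇒≤ (≰⇒> nle)))))
  ... | c , Q , sub , sQ , eq = c , Q , (λ i → proj₁ (hB _ (sub i))) , sQ , eq

  RamseyAt : (b k m n : ℕ) → Set
  RamseyAt b k m n = (χ : Subset n → ℕ) → (∀ e → χ e < b) →
                     ∃ λ c → c < b × ∃ λ P → ∣ P ∣ ≡ m × Hom k χ c P

  endRamsey : ∀ b k → (∀ m → ∃ (RamseyAt b k m)) → ∀ m → ∃ λ N → ∀ n → n ≡ N →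
              (χ : Subset n → ℕ) → (∀ e → χ e < b) → ∃ λ P → ∣ P ∣ ≡ m × EndHom b k χ P
  endRamsey b k ram zero = 0 , λ { _ refl χ _ → [] , refl , tt }
  endRamsey b k ram (suc m) with endRamsey b k ram m
  ... | N , rec with ram N
  ...   | N′ , ram′ = suc N′ , go
    where
    go : ∀ n → n ≡ suc N′ → (χ : Subset n → ℕ) → (∀ e → χ e < b) →
         ∃ λ P → ∣ P ∣ ≡ suc m × EndHom b k χ P
    go _ refl χ χ< with ram′ (χ ∘ (inside ∷_)) (λ e → χ< (inside ∷ e))
    ... | c , c<b , P , ∣P∣ , hom with rec ∣ P ∣ ∣P∣ (χ ∘ (outside ∷_) ∘ embed P) (λ e → χ< _)
    ...   | Q , ∣Q∣ , h = inside ∷ embed P Q , cong suc (trans (∣embed∣ P Q) ∣Q∣) ,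
      (c , c<b , λ e sub → hom e (embed⊆ P Q ∘ sub)) , endHom-embed (χ ∘ (outside ∷_)) P Q h

  ramsey : ∀ b k m → ∃ (RamseyAt b k m)
  ramsey b zero m = m , λ χ χ< → χ ⊥ , χ< ⊥ , ⊤ , ∣⊤∣≡n m ,
    λ e _ s → cong χ (∣p∣≡0⇒p≡⊥ e s)
  ramsey b (suc k) m with endRamsey b k (ramsey b k) (suc (b * suc m))
  ... | N , end = N , go
    where
    go : RamseyAt b (suc k) m N
    go χ χ< with end N refl χ χ<
    ... | P , ∣P∣ , h with pigeonhole b (suc m) P (head-colour P h) (head-colour< P h) (≤-reflexive (sym ∣P∣))
    ...   | c , Q , Q⊆P , ∣Q∣ , eq with nonempty? Q
    ...     | no ¬ne = contradiction (trans (sym (trans (cong ∣_∣ (Empty-unique ¬ne)) (∣⊥∣≡0 N))) ∣Q∣) λ ()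
    ...     | yes (x , i) with shrink m Q (≤-trans (n≤1+n m) (≤-reflexive (sym ∣Q∣)))
    ...       | Q′ , sub , ∣Q′∣ =
      c , subst (_< b) (eq x i) (head-colour< P h x (Q⊆P i)) , Q′ , ∣Q′∣ ,
      λ e e⊆Q′ → endHom⇒hom P h e (Q⊆P ∘ sub ∘ e⊆Q′) (λ y j → eq y (sub (e⊆Q′ j)))

  ∣p∣≤1 : ∀ {c} (S : Subset n) → (∀ x → x ∈ S → toℕ x ≡ c) → ∣ S ∣ ≤ 1
  ∣p∣≤1 {n} S eq with nonempty? S
  ... | no ¬ne = ≤-trans (≤-reflexive (trans (cong ∣_∣ (Empty-unique ¬ne)) (∣⊥∣≡0 n))) z≤n
  ... | yes (x , i) = subst (∣ S ∣ ≤_) (∣⁅x⁆∣≡1 x) (p⊆q⇒∣p∣≤∣q∣ λ {y} j →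
    subst (_∈ ⁅ x ⁆) (Fin.toℕ-injective (trans (eq x i) (sym (eq y j)))) (x∈⁅x⁆ x))

arrows-exists : ∀ k r p q → 2 ≤ q → ∃ (Arrows k r p q)
arrows-exists k r p q 2≤q with ramsey (suc r) k p
... | N , ram = N , go
  where
  go : Arrows k r p q N
  go χ with ram χ⁺ χ⁺<
    where
    -- χ extended to all subsets of Fin N, a non-edge receiving the extra colour r.
    χ⁺ : Subset N → ℕ
    χ⁺ e with ∣ e ∣ ≟ k
    ... | yes s = toℕ (χ (e , s))
    ... | no  _ = r

    χ⁺< : ∀ e → χ⁺ e < suc r
    χ⁺< e with ∣ e ∣ ≟ k
    ... | yes s = m<n⇒m<1+n (Fin.toℕ<n (χ (e , s)))
    ... | no  _ = ≤-refl
  ... | c , _ , P , ∣P∣ , hom = P , ∣P∣ ,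
    ≤-trans (∣p∣≤1 (colours χ P) λ x i → same x (∈colours⁻ χ P i)) (∸-monoˡ-≤ 1 2≤q)
    where
    same : ∀ x → Appears χ P x → toℕ x ≡ c
    same x ((e , s) , e⊆P , refl) with ∣ e ∣ ≟ k | hom e e⊆P s
    ... | yes s′ | eq = trans (cong (λ s → toℕ (χ (e , s))) (≡-irrelevant s s′)) eq
    ... | no ¬s  | _  = contradiction s ¬s

------------------------------------------------------------------------
-- The generalised Ramsey number F_k(r,p,q)

F-spec : ∀ k r p q → 2 ≤ q → ∃ (IsLeast (Arrows k r p q))
F-spec k r p q 2≤q with arrows-exists k r p q 2≤q
... | n , arr = least (arrows? k r p q) n arr

F : (k r p q : ℕ) → 2 ≤ q → ℕ
F k r p q 2≤q = proj₁ (F-spec k r p q 2≤q)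

F-isLeast : ∀ k r p q (2≤q : 2 ≤ q) → IsLeast (Arrows k r p q) (F k r p q 2≤q)
F-isLeast k r p q 2≤q = proj₂ (F-spec k r p q 2≤q)

-- F extended to all q ≥ 2 by the convention that it is p when q > p C k.
F̂ : (k r p q : ℕ) → 2 ≤ q → ℕ
F̂ k r p q 2≤q with q ≤? p C k
... | yes _ = F k r p q 2≤q
... | no  _ = p

module Submission where

-- The Erdős–Rado greedy argument.  Choose vertices x₁, …, xₜ one at a time from
-- a shrinking set S of candidates, so that the colour of a k-edge depends only
-- on the edge minus its last chosen vertex, and so that every vertex left in S
-- would continue the sequence in this way.  Choosing xᵢ₊₁ creates i C (k − 2)
-- new (k−1)-sets, and by pigeonhole S keeps a 1 / r^(i C (k − 2)) part of
-- S ∖ {xᵢ₊₁}.  These exponents add up to t C (k − 1).  The first k − 2 steps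
-- only remove a vertex, and this loss, together with that of the next step, is
-- absorbed by rounding up the first division by r because k ≤ r.  With
-- t = F_{k-1}(r,p-1,q) the colours of the truncated edges have a p−1 set with
-- few colours; adjoining one leftover vertex gives the required p-set.

open import Defs
open import Data.Fin.Base using (Fin; zero; suc; fromℕ<)
import Data.Fin.Properties as Fin
open import Data.Fin.Subset
open import Data.Fin.Subset.Properties
open import Data.Nat.Base hiding (∣_-_∣)
open import Data.Nat.Combinatorics using (_C_; k>n⇒nCk≡0; nCk+nC[k+1]≡[n+1]C[k+1])
open import Data.Nat.Properties
open import Data.Product.Base using (∃; _×_; _,_; proj₁; proj₂)
open import Data.Sum.Base using (_⊎_; inj₁; inj₂; [_,_]′)
import Data.Unit.Base as Unit
open import Data.Vec.Base using (Vec; []; _∷_; here; there; tabulate; allFin)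
open import Data.Vec.Membership.Propositional using () renaming (_∈_ to _∈ᵛ_)
open import Data.Vec.Membership.Propositional.Properties using (∈-allFin⁺)
import Data.Vec.Relation.Unary.Any as Any
open import Data.Vec.Properties using (lookup∘tabulate; []=⇒lookup; lookup⇒[]=)
open import Function.Base using (_∘_; id)
open import Relation.Binary.PropositionalEquality
open import Relation.Nullary using (yes; no; does; contradiction)
open import Relation.Nullary.Decidable using (dec-true; dec-false)

private variable
  i j k m n p q r t : ℕ

-- Cardinalities of subsets

∣p∪q∣≤∣p∣+∣q∣ : (p q : Subset n) → ∣ p ∪ q ∣ ≤ ∣ p ∣ + ∣ q ∣
∣p∪q∣≤∣p∣+∣q∣ []            []            = z≤n
∣p∪q∣≤∣p∣+∣q∣ (inside  ∷ p) (y ∷ q)       =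
  s≤s (≤-trans (∣p∪q∣≤∣p∣+∣q∣ p q) (+-monoʳ-≤ ∣ p ∣ (∣p∣≤∣x∷p∣ y q)))
∣p∪q∣≤∣p∣+∣q∣ (outside ∷ p) (inside  ∷ q) =
  ≤-trans (s≤s (∣p∪q∣≤∣p∣+∣q∣ p q)) (≤-reflexive (sym (+-suc ∣ p ∣ ∣ q ∣)))
∣p∪q∣≤∣p∣+∣q∣ (outside ∷ p) (outside ∷ q) = ∣p∪q∣≤∣p∣+∣q∣ p q

∣⁅x⁆∪p∣≡1+∣p∣ : {x : Fin n} {p : Subset n} → x ∉ p → ∣ ⁅ x ⁆ ∪ p ∣ ≡ suc ∣ p ∣
∣⁅x⁆∪p∣≡1+∣p∣ {x = zero}  {inside  ∷ p} x∉p = contradiction here x∉p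
∣⁅x⁆∪p∣≡1+∣p∣ {x = zero}  {outside ∷ p} x∉p = cong (suc ∘ ∣_∣) (∪-identityˡ p)
∣⁅x⁆∪p∣≡1+∣p∣ {x = suc x} {inside  ∷ p} x∉p = cong suc (∣⁅x⁆∪p∣≡1+∣p∣ (x∉p ∘ there))
∣⁅x⁆∪p∣≡1+∣p∣ {x = suc x} {outside ∷ p} x∉p = ∣⁅x⁆∪p∣≡1+∣p∣ (x∉p ∘ there)

x∈p─q⇒x∉q : {x : Fin n} (p q : Subset n) → x ∈ p ─ q → x ∉ q
x∈p─q⇒x∉q (_ ∷ p) (_ ∷ q) (there x∈) (there x∈q) = x∈p─q⇒x∉q p q x∈ x∈q

p⊆q∪[p─q] : (p q : Subset n) → p ⊆ q ∪ (p ─ q)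
p⊆q∪[p─q] p q {x} x∈p with x ∈? q
... | yes x∈q = x∈p∪q⁺ (inj₁ x∈q)
... | no  x∉q = x∈p∪q⁺ (inj₂ (x∈p∧x∉q⇒x∈p─q x∈p x∉q))

∣p∣≤∣p∩q∣+∣p─q∣ : (p q : Subset n) → ∣ p ∣ ≤ ∣ p ∩ q ∣ + ∣ p ─ q ∣
∣p∣≤∣p∩q∣+∣p─q∣ p q = ≤-trans (p⊆q⇒∣p∣≤∣q∣ sub) (∣p∪q∣≤∣p∣+∣q∣ (p ∩ q) (p ─ q))
  where
  sub : p ⊆ (p ∩ q) ∪ (p ─ q)
  sub x∈p with x∈p∪q⁻ q (p ─ q) (p⊆q∪[p─q] p q x∈p)
  ... | inj₁ x∈q = x∈p∪q⁺ (inj₁ (x∈p∩q⁺ (x∈p , x∈q)))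
  ... | inj₂ x∈  = x∈p∪q⁺ (inj₂ x∈)

∣p∣≤1+∣p-x∣ : (p : Subset n) (x : Fin n) → ∣ p ∣ ≤ suc ∣ p - x ∣
∣p∣≤1+∣p-x∣ p x = begin
  ∣ p ∣                    ≤⟨ p⊆q⇒∣p∣≤∣q∣ (p⊆q∪[p─q] p ⁅ x ⁆) ⟩
  ∣ ⁅ x ⁆ ∪ (p - x) ∣      ≤⟨ ∣p∪q∣≤∣p∣+∣q∣ ⁅ x ⁆ (p - x) ⟩
  ∣ ⁅ x ⁆ ∣ + ∣ p - x ∣    ≡⟨ cong (_+ ∣ p - x ∣) (∣⁅x⁆∣≡1 x) ⟩
  suc ∣ p - x ∣            ∎
  where open ≤-Reasoning

Empty⇒∣p∣≡0 : {p : Subset n} → Empty p → ∣ p ∣ ≡ 0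
Empty⇒∣p∣≡0 {n} ¬ne = trans (cong ∣_∣ (Empty-unique ¬ne)) (∣⊥∣≡0 n)

0<∣p∣⇒Nonempty : {p : Subset n} → 0 < ∣ p ∣ → Nonempty p
0<∣p∣⇒Nonempty {p = p} 0<∣p∣ with nonempty? p
... | yes ne = ne
... | no ¬ne = contradiction (Empty⇒∣p∣≡0 ¬ne) (>⇒≢ 0<∣p∣)

-- Pigeonhole

fibre : (Fin n → Fin r) → Fin r → Subset n
fibre g c = tabulate λ y → does (g y Fin.≟ c)

∈fibre⁻ : (g : Fin n → Fin r) {c : Fin r} {y : Fin n} → y ∈ fibre g c → g y ≡ c
∈fibre⁻ g {c} {y} y∈ with g y Fin.≟ c
... | yes eq = eq
... | no neq = contradiction
  (trans (sym ([]=⇒lookup y∈)) (trans (lookup∘tabulate _ y) (dec-false (g y Fin.≟ c) neq))) λ ()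

∈fibre⁺ : (g : Fin n → Fin r) {c : Fin r} {y : Fin n} → g y ≡ c → y ∈ fibre g c
∈fibre⁺ g {c} {y} eq = lookup⇒[]= y (fibre g c)
  (trans (lookup∘tabulate _ y) (dec-true (g y Fin.≟ c) eq))

-- Induction on the palette: keep the larger of the fibre of `c` and the class found in the
-- remainder. `c₀` labels the class when the palette, and hence `S`, is empty.
pigeonhole-among : Fin r → (cs : Vec (Fin r) m) (g : Fin n → Fin r) (S : Subset n) →
  (∀ {y} → y ∈ S → g y ∈ᵛ cs) →
  ∃ λ T → ∃ λ c → T ⊆ S × (∀ {y} → y ∈ T → g y ≡ c) × ∣ S ∣ ≤ m * ∣ T ∣
pigeonhole-among c₀ [] g S g∈ =
  S , c₀ , id , (λ y∈ → contradiction (g∈ y∈) λ ()) ,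
  ≤-reflexive (Empty⇒∣p∣≡0 λ (_ , y∈) → contradiction (g∈ y∈) λ ())
pigeonhole-among {m = suc m} c₀ (c ∷ cs) g S g∈
  with pigeonhole-among c₀ cs g (S ─ fibre g c) g∈cs
  where
  g∈cs : ∀ {y} → y ∈ S ─ fibre g c → g y ∈ᵛ cs
  g∈cs y∈ with g∈ (p─q⊆p S (fibre g c) y∈)
  ... | Any.here eq  = contradiction (∈fibre⁺ g eq) (x∈p─q⇒x∉q S (fibre g c) y∈)
  ... | Any.there g∈ = g∈
... | T , d , T⊆ , T≡d , bound with ≤-total ∣ S ∩ fibre g c ∣ ∣ T ∣
...   | inj₁ le = T , d , p─q⊆p S (fibre g c) ∘ T⊆ , T≡d ,
  ≤-trans (∣p∣≤∣p∩q∣+∣p─q∣ S (fibre g c)) (+-mono-≤ le bound)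
...   | inj₂ ge = S ∩ fibre g c , c , proj₁ ∘ x∈p∩q⁻ S (fibre g c) ,
  ∈fibre⁻ g ∘ proj₂ ∘ x∈p∩q⁻ S (fibre g c) ,
  ≤-trans (∣p∣≤∣p∩q∣+∣p─q∣ S (fibre g c))
    (+-monoʳ-≤ ∣ S ∩ fibre g c ∣ (≤-trans bound (*-monoʳ-≤ m ge)))

pigeonhole : Fin r → (g : Fin n → Fin r) (S : Subset n) →
  ∃ λ T → ∃ λ c → T ⊆ S × (∀ {y} → y ∈ T → g y ≡ c) × ∣ S ∣ ≤ r * ∣ T ∣
pigeonhole {r} c₀ g S = pigeonhole-among c₀ (allFin r) g S λ {y} _ → ∈-allFin⁺ (g y)

-- One pigeonhole per `j`-set, each applied to what the previous one left, at a factor `r` every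
-- time. The recursion follows Pascal's rule: first the sets through the first position, then the
-- others.
simultaneous-pigeonhole : Fin r → ∀ i j (g : Subset i → Fin n → Fin r) (S : Subset n) →
  ∃ λ T → ∃ λ (d : Subset i → Fin r) → T ⊆ S × (∀ e → ∣ e ∣ ≡ j → ∀ {y} → y ∈ T → g e y ≡ d e) ×
  ∣ S ∣ ≤ r ^ (i C j) * ∣ T ∣
simultaneous-pigeonhole {r} c₀ zero zero g S with pigeonhole c₀ (g []) S
... | T , c , T⊆S , T≡c , bound =
  T , (λ _ → c) , T⊆S , (λ { [] _ → T≡c }) ,
  subst (λ s → ∣ S ∣ ≤ s * ∣ T ∣) (sym (*-identityʳ r)) bound
simultaneous-pigeonhole c₀ zero (suc j) g S =
  S , (λ _ → c₀) , id , (λ { [] () }) , ≤-reflexive (sym (*-identityˡ ∣ S ∣))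
simultaneous-pigeonhole c₀ (suc i) zero g S
  with simultaneous-pigeonhole c₀ i zero (g ∘ (outside ∷_)) S
... | T , d , T⊆S , T≡d , bound =
  T , (λ { (_ ∷ e) → d e }) , T⊆S ,
  (λ { (outside ∷ e) s → T≡d e s ; (inside ∷ e) () }) , bound
simultaneous-pigeonhole {r} c₀ (suc i) (suc j) g S
  with simultaneous-pigeonhole c₀ i j (g ∘ (inside ∷_)) S
... | T , d , T⊆S , T≡d , bound
  with simultaneous-pigeonhole c₀ i (suc j) (g ∘ (outside ∷_)) T
...   | T′ , d′ , T′⊆T , T′≡d′ , bound′ =
  T′ , (λ { (inside ∷ e) → d e ; (outside ∷ e) → d′ e }) , T⊆S ∘ T′⊆T ,
  (λ { (inside ∷ e) s y∈ → T≡d e (suc-injective s) (T′⊆T y∈) ; (outside ∷ e) → T′≡d′ e }) ,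
  (begin
    ∣ S ∣                                             ≤⟨ bound ⟩
    r ^ (i C j) * ∣ T ∣                               ≤⟨ *-monoʳ-≤ (r ^ (i C j)) bound′ ⟩
    r ^ (i C j) * (r ^ (i C suc j) * ∣ T′ ∣)          ≡⟨ *-assoc (r ^ (i C j)) _ _ ⟨
    r ^ (i C j) * r ^ (i C suc j) * ∣ T′ ∣            ≡⟨ cong (_* ∣ T′ ∣) (^-distribˡ-+-* r (i C j) _) ⟨
    r ^ (i C j + i C suc j) * ∣ T′ ∣
      ≡⟨ cong (λ e → r ^ e * ∣ T′ ∣) (nCk+nC[k+1]≡[n+1]C[k+1] i j) ⟩
    r ^ (suc i C suc j) * ∣ T′ ∣                      ∎)
  where open ≤-Reasoning

-- Sequences of vertices

-- The newest vertex is at the head, so the last vertex of an edge of the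
-- sequence is its first element in the Subset vector.
image : Vec (Fin n) i → Subset i → Subset n
image []       _             = ⊥
image (x ∷ xs) (inside  ∷ e) = ⁅ x ⁆ ∪ image xs e
image (x ∷ xs) (outside ∷ e) = image xs e

-- Whether `x ∈ e` decides if the head position is taken; `e - x` is left to the tail.
⊆image⁻ : (xs : Vec (Fin n) i) (P : Subset i) (e : Subset n) → e ⊆ image xs P →
          ∃ λ e′ → e′ ⊆ P × image xs e′ ≡ e
⊆image⁻ [] [] e e⊆ = [] , id , ⊆-antisym (⊆-min e) e⊆
⊆image⁻ (x ∷ xs) (outside ∷ P) e e⊆ with ⊆image⁻ xs P e e⊆
... | e′ , e′⊆P , eq = outside ∷ e′ , out⊆ e′⊆P , eq
⊆image⁻ (x ∷ xs) (inside ∷ P) e e⊆ with ⊆image⁻ xs P (e - x) e-x⊆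
  where
  e-x⊆ : e - x ⊆ image xs P
  e-x⊆ y∈ with x∈p∪q⁻ ⁅ x ⁆ (image xs P) (e⊆ (p─q⊆p e ⁅ x ⁆ y∈))
  ... | inj₁ y∈⁅x⁆ = contradiction y∈⁅x⁆ (x∈p─q⇒x∉q e ⁅ x ⁆ y∈)
  ... | inj₂ y∈xs  = y∈xs
... | e′ , e′⊆P , eq with x ∈? e
...   | yes x∈e = inside ∷ e′ , in⊆in e′⊆P ,
  trans (cong (⁅ x ⁆ ∪_) eq) (⊆-antisym back (p⊆q∪[p─q] e ⁅ x ⁆))
  where
  back : ⁅ x ⁆ ∪ (e - x) ⊆ e
  back y∈ with x∈p∪q⁻ ⁅ x ⁆ (e - x) y∈
  ... | inj₁ y∈⁅x⁆ = subst (_∈ e) (sym (x∈⁅y⁆⇒x≡y x y∈⁅x⁆)) x∈e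
  ... | inj₂ y∈e-x = p─q⊆p e ⁅ x ⁆ y∈e-x
...   | no  x∉e = outside ∷ e′ , out⊆ e′⊆P ,
  trans eq (⊆-antisym (p─q⊆p e ⁅ x ⁆) λ y∈e → x∈p∧x≢y⇒x∈p-y y∈e λ { refl → x∉e y∈e })

-- f (image xs e) is c of e minus its last vertex.
EndDetermined : ℕ → (Subset n → Fin r) → Vec (Fin n) i → (Subset i → Fin r) → Set
EndDetermined k f []       c = Unit.⊤
EndDetermined k f (x ∷ xs) c =
  (∀ e → ∣ e ∣ ≡ k → f (⁅ x ⁆ ∪ image xs e) ≡ c (outside ∷ e)) ×
  EndDetermined k f xs (c ∘ (outside ∷_))

-- Skip positions down to the newest vertex of `e`; the clause of `EndDetermined` there gives the
-- colour.
truncate : {f : Subset n → Fin r} (xs : Vec (Fin n) i) {c : Subset i → Fin r} →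
           EndDetermined k f xs c → ∀ e → ∣ e ∣ ≡ suc k →
           ∃ λ e′ → e′ ⊆ e × ∣ e′ ∣ ≡ k × f (image xs e) ≡ c e′
truncate (x ∷ xs) (last , _) (inside ∷ e) s =
  outside ∷ e , out⊆ id , suc-injective s , last e (suc-injective s)
truncate (x ∷ xs) (_ , end) (outside ∷ e) s with truncate xs end e s
... | e′ , e′⊆e , s′ , eq = outside ∷ e′ , out⊆ e′⊆e , s′ , eq

-- `size`, stated for all `e`, encodes that the vertices are distinct. `next` is the invariant that
-- lets the chain grow: at the vertex chosen it becomes the new clause of `end`.
record Chain (k : ℕ) (f : Subset n → Fin r) (i : ℕ) (S : Subset n) : Set where
  field
    vertices : Vec (Fin n) i
    colour   : Subset i → Fin r
    size     : ∀ e → ∣ image vertices e ∣ ≡ ∣ e ∣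
    fresh    : ∀ {y} → y ∈ S → ∀ e → y ∉ image vertices e
    end      : EndDetermined k f vertices colour
    next     : ∀ {y} → y ∈ S → ∀ e → ∣ e ∣ ≡ k → f (⁅ y ⁆ ∪ image vertices e) ≡ colour e

start : Fin r → (f : Subset n → Fin r) → Chain (suc j) f 0 ⊤
start {n = n} c₀ f = record
  { vertices = []
  ; colour   = λ _ → c₀
  ; size     = λ { [] → ∣⊥∣≡0 n }
  ; fresh    = λ _ _ → ∉⊥
  ; end      = Unit.tt
  ; next     = λ { _ [] () }
  }

-- Sets avoiding `x` keep their colours because `T ⊆ S`. Those through `x` correspond to `j`-sets of
-- old positions, whence the exponent; the `suc` pays for removing `x` itself.
extend : {f : Subset n → Fin r} {S : Subset n} → Fin r → Chain (suc j) f i S → Nonempty S →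
         ∃ λ T → Chain (suc j) f (suc i) T × ∣ S ∣ ≤ suc (r ^ (i C j) * ∣ T ∣)
extend {n} {r} {j} {i} {f} {S} c₀ Γ (x , x∈S)
  with simultaneous-pigeonhole c₀ i j
         (λ e y → f (⁅ y ⁆ ∪ (⁅ x ⁆ ∪ image (Chain.vertices Γ) e))) (S - x)
... | T , d , T⊆S-x , T≡d , bound = T , Γ′ , ≤-trans (∣p∣≤1+∣p-x∣ S x) (s≤s bound)
  where
  open Chain Γ
  T⊆S : T ⊆ S
  T⊆S = p─q⊆p S ⁅ x ⁆ ∘ T⊆S-x

  colour′ : Subset (suc i) → Fin r
  colour′ (inside  ∷ e) = d e
  colour′ (outside ∷ e) = colour e

  fresh′ : ∀ {y} → y ∈ T → ∀ e → y ∉ image (x ∷ vertices) e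
  fresh′ y∈T (outside ∷ e) y∈ = fresh (T⊆S y∈T) e y∈
  fresh′ y∈T (inside  ∷ e) y∈ with x∈p∪q⁻ ⁅ x ⁆ (image vertices e) y∈
  ... | inj₁ y∈⁅x⁆ = x∈p─q⇒x∉q S ⁅ x ⁆ (T⊆S-x y∈T) y∈⁅x⁆
  ... | inj₂ y∈e   = fresh (T⊆S y∈T) e y∈e

  Γ′ : Chain (suc j) f (suc i) T
  Γ′ = record
    { vertices = x ∷ vertices
    ; colour   = colour′
    ; size     = λ { (inside  ∷ e) → trans (∣⁅x⁆∪p∣≡1+∣p∣ (fresh x∈S e)) (cong suc (size e))
                   ; (outside ∷ e) → size e }
    ; fresh    = fresh′
    ; end      = next x∈S , end
    ; next     = λ { y∈T (inside  ∷ e) s → T≡d e (suc-injective s) y∈T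
                   ; y∈T (outside ∷ e) s → next (T⊆S y∈T) e s }
    }

-- Counting the candidates

k≤n⇒0<nCk : k ≤ n → 0 < n C k
k≤n⇒0<nCk {zero}        _         = s≤s z≤n
k≤n⇒0<nCk {suc k} {suc n} (s≤s k≤n) =
  subst (0 <_) (nCk+nC[k+1]≡[n+1]C[k+1] n k) (m≤n⇒m≤n+o (n C suc k) (k≤n⇒0<nCk k≤n))

-- The exponent of `r` still to be spent with `i` vertices chosen and `m` to come.
columnSum : (j i m : ℕ) → ℕ
columnSum j i zero    = 0
columnSum j i (suc m) = i C j + columnSum j (suc i) m

-- The hockey-stick identity, by repeated use of Pascal's rule.
columnSum+iC[j+1] : ∀ j i m → m + i ≡ t → columnSum j i m + i C suc j ≡ t C suc j
columnSum+iC[j+1] j i zero    refl = refl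
columnSum+iC[j+1] {t} j i (suc m) eq = begin
  i C j + s + i C suc j     ≡⟨ cong (_+ i C suc j) (+-comm (i C j) s) ⟩
  s + i C j + i C suc j     ≡⟨ +-assoc s (i C j) (i C suc j) ⟩
  s + (i C j + i C suc j)   ≡⟨ cong (s +_) (nCk+nC[k+1]≡[n+1]C[k+1] i j) ⟩
  s + suc i C suc j         ≡⟨ columnSum+iC[j+1] j (suc i) m (trans (+-suc m i) eq) ⟩
  t C suc j                 ∎
  where
  open ≡-Reasoning
  s = columnSum j (suc i) m

-- For `j ≤ i` the first term is positive. Otherwise `i C suc j` vanishes and the sum is all of
-- `t C suc j`. This keeps `S` nonempty before each step.
0<columnSum : ∀ j i m → suc m + i ≡ t → j < t → 0 < columnSum j i (suc m)
0<columnSum {t} j i m eq j<t with j ≤? i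
... | yes j≤i = m≤n⇒m≤n+o (columnSum j (suc i) m) (k≤n⇒0<nCk j≤i)
... | no  j≰i = subst (0 <_) (sym all) (k≤n⇒0<nCk j<t)
  where
  all : columnSum j i (suc m) ≡ t C suc j
  all = trans (sym (+-identityʳ _))
    (trans (cong (columnSum j i (suc m) +_) (sym (k>n⇒nCk≡0 (m<n⇒m<1+n (≰⇒> j≰i)))))
           (columnSum+iC[j+1] j i (suc m) eq))

divide-rounding-up : ∀ {a b s δ} → suc δ < a → a * b ≤ suc (a * s) + δ → b ≤ s
divide-rounding-up {a} {b} {s} {δ} δ< le = ≤-pred (*-cancelˡ-< a b (suc s) (begin-strict
  a * b             ≤⟨ le ⟩
  suc (a * s) + δ   ≡⟨ cong suc (+-comm (a * s) δ) ⟩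
  suc δ + a * s     <⟨ +-monoˡ-< (a * s) δ< ⟩
  a + a * s         ≡⟨ *-suc a s ⟨
  a * suc s         ∎))
  where open ≤-Reasoning

-- δ is the loss from the steps made so far without a division by r.
grow : {f : Subset n → Fin r} → Fin r → suc j < r → j < t → ∀ m i δ {S} → m + i ≡ t →
       Chain (suc j) f i S → δ ≡ 0 ⊎ (δ ≤ i × i ≤ j) → r ^ columnSum j i m ≤ ∣ S ∣ + δ →
       ∃ λ T → Chain (suc j) f t T × Nonempty T
grow c₀ 1+j<r j<t zero i δ {S} refl Γ (inj₁ refl) bound =
  S , Γ , 0<∣p∣⇒Nonempty (subst (1 ≤_) (+-identityʳ ∣ S ∣) bound)
-- Here `i` is `t`, which exceeds `j`, so no loss can still be pending.
grow c₀ 1+j<r j<t zero i δ refl Γ (inj₂ (_ , i≤j)) bound = contradiction i≤j (<⇒≱ j<t)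
grow {r = r@(suc _)} {j} {t} c₀ 1+j<r j<t (suc m) i δ {S} eq Γ slack bound = go
  where
  s = columnSum j (suc i) m

  eq′ : m + suc i ≡ t
  eq′ = trans (+-suc m i) eq

  δ≤j : δ ≤ j
  δ≤j = [ (λ δ≡0 → subst (_≤ j) (sym δ≡0) z≤n) , (λ (δ≤i , i≤j) → ≤-trans δ≤i i≤j) ]′ slack

  δ≤i : δ ≤ i
  δ≤i = [ (λ δ≡0 → subst (_≤ i) (sym δ≡0) z≤n) , proj₁ ]′ slack

  -- This is where `k ≤ r` enters: with `k = j + 2`, one division by `r` absorbs up to `j` earlier
  -- losses and the current one.
  1+δ<r^ : ∀ {e} → 0 < e → suc δ < r ^ e
  1+δ<r^ {suc e} _ = <-≤-trans (≤-<-trans (s≤s δ≤j) 1+j<r) (m≤m*n r (r ^ e) {{m^n≢0 r e}})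

  0<∣S∣ : 0 < ∣ S ∣
  0<∣S∣ = +-cancelʳ-< δ 0 ∣ S ∣
    (<-≤-trans (<⇒≤ (1+δ<r^ (0<columnSum j i m eq j<t))) bound)

  go : ∃ λ T → Chain _ _ t T × Nonempty T
  go with extend c₀ Γ (0<∣p∣⇒Nonempty 0<∣S∣) | j ≤? i
  -- A genuine division: rounding up resets the loss to 0.
  ... | T , Γ′ , ∣S∣≤ | yes j≤i = grow c₀ 1+j<r j<t m (suc i) 0 eq′ Γ′ (inj₁ refl)
    (subst (r ^ s ≤_) (sym (+-identityʳ ∣ T ∣))
      (divide-rounding-up (1+δ<r^ (k≤n⇒0<nCk j≤i))
        (≤-trans (≤-reflexive (sym (^-distribˡ-+-* r (i C j) s)))
          (≤-trans bound (+-monoˡ-≤ δ ∣S∣≤)))))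
  -- No `j`-set exists yet, so nothing is divided and the removed vertex is added to the loss.
  ... | T , Γ′ , ∣S∣≤ | no j≰i = grow c₀ 1+j<r j<t m (suc i) (suc δ) eq′ Γ′
    (inj₂ (s≤s δ≤i , ≰⇒> j≰i)) (begin
      r ^ s                           ≡⟨ cong (λ e → r ^ (e + s)) iCj≡0 ⟨
      r ^ (i C j + s)                 ≤⟨ bound ⟩
      ∣ S ∣ + δ                       ≤⟨ +-monoˡ-≤ δ ∣S∣≤ ⟩
      suc (r ^ (i C j) * ∣ T ∣) + δ   ≡⟨ cong (λ e → suc (r ^ e * ∣ T ∣) + δ) iCj≡0 ⟩
      suc (1 * ∣ T ∣) + δ             ≡⟨ cong (λ x → suc x + δ) (*-identityˡ ∣ T ∣) ⟩
      suc ∣ T ∣ + δ                   ≡⟨ +-suc ∣ T ∣ δ ⟨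
      ∣ T ∣ + suc δ                   ∎)
    where
    open ≤-Reasoning
    iCj≡0 : i C j ≡ 0
    iCj≡0 = k>n⇒nCk≡0 (≰⇒> j≰i)

-- Arrow relations

-- Makes `χ` total, so that an `image` can be coloured without a proof of its size.
totalise : Fin r → Colouring k r n → Subset n → Fin r
totalise {k = k} c₀ χ e with ∣ e ∣ ≟ k
... | yes s = χ (e , s)
... | no  _ = c₀

totalise-edge : (c₀ : Fin r) (χ : Colouring k r n) ((e , s) : Edge k n) →
                totalise c₀ χ e ≡ χ (e , s)
totalise-edge {k = k} c₀ χ (e , s) with ∣ e ∣ ≟ k
... | yes s′ = cong (λ s → χ (e , s)) (≡-irrelevant s′ s)
... | no  ¬s = contradiction s ¬s

-- Any colouring produces a `p`-set, so a constant one will do. This yields the `j < t` required by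
-- `grow`.
Arrows⇒p≤n : Fin r → Arrows k r p q n → p ≤ n
Arrows⇒p≤n c₀ arr with arr (λ _ → c₀)
... | P , ∣P∣≡p , _ = subst (_≤ _) ∣P∣≡p (∣p∣≤n P)

arrows-suc : Fin r → suc j < r → suc j ≤ p → Arrows (suc j) r p q t →
             Arrows (suc (suc j)) r (suc p) q (r ^ (t C suc j))
arrows-suc {r} {j} {p} {q} {t} c₀ 1+j<r j<p arr χ
  with grow {f = totalise c₀ χ} c₀ 1+j<r (≤-trans j<p (Arrows⇒p≤n {q = q} c₀ arr)) t 0 0
         (+-identityʳ t) (start c₀ _) (inj₁ refl)
         (≤-reflexive (trans (cong (r ^_) exponent) (sym (trans (+-identityʳ _) (∣⊤∣≡n _)))))
  where
  exponent : columnSum j 0 t ≡ t C suc j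
  exponent = trans (sym (+-identityʳ _)) (columnSum+iC[j+1] j 0 t (+-identityʳ t))
... | S , Γ , y , y∈S = few (arr ψ)
  where
  open Chain Γ
  ψ : Colouring (suc j) r t
  ψ (e , _) = colour e

  few : FewColours p q ψ → FewColours (suc p) q χ
  few (P , ∣P∣≡p , ∣ψP∣≤) = P⁺ ,
    trans (∣⁅x⁆∪p∣≡1+∣p∣ (fresh y∈S P)) (cong suc (trans (size P) ∣P∣≡p)) ,
    ≤-trans (p⊆q⇒∣p∣≤∣q∣ colours⊆) ∣ψP∣≤
    where
    P⁺ : Subset _
    P⁺ = image (y ∷ vertices) (inside ∷ P)

    -- As `y` comes last, an edge through `y` truncates to its part in `P`, by `next`; any other
    -- edge loses its own last vertex, by `truncate`. Either way the colour already occurs under `ψ`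
    -- on `P`.
    appears : ∀ {c} (e′ : Subset (suc t)) → e′ ⊆ inside ∷ P →
              ∣ image (y ∷ vertices) e′ ∣ ≡ suc (suc j) →
              totalise c₀ χ (image (y ∷ vertices) e′) ≡ c → Appears ψ P c
    appears (inside ∷ e) e⊆ s eq = (e , s′) , drop-∷-⊆ e⊆ , trans (sym (next y∈S e s′)) eq
      where
      s′ : ∣ e ∣ ≡ suc j
      s′ = trans (sym (size e))
        (suc-injective (trans (sym (∣⁅x⁆∪p∣≡1+∣p∣ (fresh y∈S e))) s))
    appears (outside ∷ e) e⊆ s eq with truncate vertices end e (trans (sym (size e)) s)
    ... | e′ , e′⊆e , s′ , eq′ = (e′ , s′) , drop-∷-⊆ e⊆ ∘ e′⊆e , trans (sym eq′) eq

    colours⊆ : colours χ P⁺ ⊆ colours ψ P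
    colours⊆ c∈ with ∈colours⁻ χ P⁺ c∈
    ... | (e , s) , e⊆ , χe≡c with ⊆image⁻ (y ∷ vertices) (inside ∷ P) e e⊆
    ...   | e′ , e′⊆ , refl =
      ∈colours⁺ ψ P (appears e′ e′⊆ s (trans (totalise-edge c₀ χ (e , s)) χe≡c))

-- Pascal's rule again, splitting edges by whether they contain the first vertex.
values-on-edges : ∀ k n (f : Subset n → Fin r) →
                  ∃ λ Q → ∣ Q ∣ ≤ n C k × (∀ e → ∣ e ∣ ≡ k → f e ∈ Q)
values-on-edges zero zero f =
  ⁅ f [] ⁆ , ≤-reflexive (∣⁅x⁆∣≡1 (f [])) , λ { [] _ → x∈⁅x⁆ (f []) }
values-on-edges {r} (suc k) zero f = ⊥ , ≤-reflexive (∣⊥∣≡0 r) , λ { [] () }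
values-on-edges zero (suc n) f with values-on-edges zero n (f ∘ (outside ∷_))
... | Q , ∣Q∣≤ , f∈Q = Q , ∣Q∣≤ , λ { (outside ∷ e) → f∈Q e ; (inside ∷ e) () }
values-on-edges (suc k) (suc n) f
  with values-on-edges k n (f ∘ (inside ∷_)) | values-on-edges (suc k) n (f ∘ (outside ∷_))
... | Q , ∣Q∣≤ , f∈Q | Q′ , ∣Q′∣≤ , f∈Q′ = Q ∪ Q′ ,
  ≤-trans (∣p∪q∣≤∣p∣+∣q∣ Q Q′)
    (≤-trans (+-mono-≤ ∣Q∣≤ ∣Q′∣≤) (≤-reflexive (nCk+nC[k+1]≡[n+1]C[k+1] n k))) ,
  λ { (inside  ∷ e) s → x∈p∪q⁺ (inj₁ (f∈Q e (suc-injective s)))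
    ; (outside ∷ e) s → x∈p∪q⁺ (inj₂ (f∈Q′ e s)) }

-- Justifies the convention in `F̂`: all `p` vertices together span too few edges to show `q`
-- colours.
arrows-trivial : Fin r → p C k < q → Arrows k r p q p
arrows-trivial {p = p} {k} {q} c₀ pCk<q χ with values-on-edges k p (totalise c₀ χ)
... | Q , ∣Q∣≤ , f∈Q = ⊤ , ∣⊤∣≡n p ,
  ≤-trans (p⊆q⇒∣p∣≤∣q∣ colours⊆Q) (≤-trans ∣Q∣≤ (∸-monoˡ-≤ 1 pCk<q))
  where
  colours⊆Q : colours χ ⊤ ⊆ Q
  colours⊆Q c∈ with ∈colours⁻ χ ⊤ c∈
  ... | (e , s) , _ , refl = subst (_∈ Q) (totalise-edge c₀ χ (e , s)) (f∈Q e s)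

arrows-F̂ : Fin r → ∀ k p q (2≤q : 2 ≤ q) → Arrows k r p q (F̂ k r p q 2≤q)
arrows-F̂ {r} c₀ k p q 2≤q with q ≤? p C k
... | yes _  = proj₁ (F-isLeast k r p q 2≤q)
... | no q≰  = arrows-trivial c₀ (≰⇒> q≰)

theorem1p4 : ∀ (r k p q : ℕ) → 1 < r → 1 < k → 1 < p → (2≤q : 2 ≤ q) →
    k ≤ r → suc k ≤ p → q ≤ p C k →
    F k r p q 2≤q ≤ r ^ (F̂ (k ∸ 1) r (p ∸ 1) q 2≤q C (k ∸ 1))
theorem1p4 r 1 _ _ _ (s≤s ())
theorem1p4 r k@(suc (suc j)) p@(suc p′) q 1<r _ _ 2≤q k≤r 1+k≤p _ =
  -- Minimality is needed only for `k`; for `k - 1` it is enough that `F̂` has the arrow property.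
  proj₂ (F-isLeast k r p q 2≤q) _
    (arrows-suc {q = q} c₀ k≤r (<⇒≤ (≤-pred 1+k≤p)) (arrows-F̂ c₀ (suc j) p′ q 2≤q))
  where
  c₀ : Fin r
  c₀ = fromℕ< (<⇒≤ 1<r)
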